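{- Let $G$ be a simple, connected graph on $n\ge 2$ vertices and $m\ge 1$ edges, let $\{u,v\}\in E(G)$ and $i\in V(G)$. If $d(i,u)=d(i,v)$ and $\gamma_{i\to u}$ is a shortest walk from vertex $i$ to vertex $u$, then there exists a shortest walk $\gamma'_{i\to v}$ from vertex $i$ to vertex $v$ such that $\gamma'_{i\to v}\cup\gamma_{i\to u}\cup\{u,v\}$ forms an odd unicyclic subgraph of $G$.
   Context: $G$ is a finite undirected graph and $d$ is the usual graph distance. The union $\gamma'_{i\to v}\cup\gamma_{i\to u}\cup\{u,v\}$ is the subgraph of $G$ consisting of the vertices and edges traversed by the two walks together with the edge $\{u,v\}$. An odd unicyclic graph is a connected graph with exactly one cycle, that cycle having odd length. -}

module Defs where

open import Data.Fin using (Fin; _<?_)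
open import Data.Fin.Properties using (_≟_; any?)
open import Data.List as List using (List; []; _∷_; map; filter; allFin; cartesianProduct)
open import Data.List.Membership.Propositional using (_∈_)
open import Data.List.Membership.Propositional.Properties using (∈-map⁺)
open import Data.List.Relation.Unary.Any using (here; there)
open import Data.List.Relation.Unary.Unique.Propositional using (Unique)
open import Data.Nat using (ℕ; zero; suc; _≤_; z≤n; s≤s)
open import Data.Nat.Divisibility using (_∤_)
open import Data.Nat.Properties using (suc-injective)
open import Data.Product using (Σ; ∃; _×_; _,_; proj₁; proj₂)
open import Data.Sum using (_⊎_; inj₁; inj₂; [_,_]; swap)
open import Function using (_∘_; _⇔_)
open import Level using (0ℓ)
open import Relation.Binary using (Rel; Symmetric; Irreflexive; Decidable)
open import Relation.Binary.Construct.Closure.ReflexiveTransitive using (Star; ε; _◅_)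
open import Relation.Binary.PropositionalEquality using (_≡_; refl; sym; cong)
open import Relation.Nullary using (Dec; yes; no; contradiction)
open import Relation.Nullary.Decidable using (map′; _×-dec_)
import Relation.Unary as Pred
open Pred using (Pred)

record SimpleGraph (n : ℕ) : Set₁ where
  field
    Adj     : Rel (Fin n) 0ℓ
    symm    : Symmetric Adj
    irrefl  : Irreflexive _≡_ Adj
    adj?    : Decidable Adj

  -- Each edge is counted once, through its ordered pair with the smaller end first.
  size : ℕ
  size = List.length
    (filter (λ p → (proj₁ p <? proj₂ p) ×-dec adj? (proj₁ p) (proj₂ p))
            (cartesianProduct (allFin n) (allFin n)))

-- Walks along a relation R are elements of Star R; they may repeat vertices and edges.
module _ {V : Set} {R : Rel V 0ℓ} where

  steps : ∀ {i j} → Star R i j → List (V × V)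
  steps ε                         = []
  steps (_◅_ {i = i} {j = j} _ w) = (i , j) ∷ steps w

  len : ∀ {i j} → Star R i j → ℕ
  len w = List.length (steps w)

  Visits : ∀ {i j} → Star R i j → Pred V 0ℓ
  Visits {i} w x = x ∈ i ∷ map proj₂ (steps w)

  Traverses : ∀ {i j} → Star R i j → Rel V 0ℓ
  Traverses w x y = ((x , y) ∈ steps w) ⊎ ((y , x) ∈ steps w)

  IsShortest : ∀ {i j} → Star R i j → Set
  IsShortest {i} {j} w = (w′ : Star R i j) → len w ≤ len w′

  -- The targets of the steps of a closed walk list its vertices with the
  -- coinciding first and last vertex counted once.
  IsCycle : ∀ {i} → Star R i i → Set
  IsCycle w = 3 ≤ len w × Unique (map proj₂ (steps w))

  visits-source : ∀ {i j} (w : Star R i j) {x y} → (x , y) ∈ steps w → Visits w x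
  visits-source (_ ◅ w) (here refl) = here refl
  visits-source (_ ◅ w) (there p)   = there (visits-source w p)

  traverses-visits : ∀ {i j} (w : Star R i j) {x y} → Traverses w x y → Visits w x
  traverses-visits w = [ visits-source w , there ∘ ∈-map⁺ proj₂ ]

  traverses⇒R : Symmetric R → ∀ {i j} (w : Star R i j) {x y} → Traverses w x y → R x y
  traverses⇒R s (e ◅ w) (inj₁ (here refl)) = e
  traverses⇒R s (e ◅ w) (inj₁ (there p))   = traverses⇒R s w (inj₁ p)
  traverses⇒R s (e ◅ w) (inj₂ (here refl)) = s e
  traverses⇒R s (e ◅ w) (inj₂ (there p))   = traverses⇒R s w (inj₂ p)

least : {P : ℕ → Set} → Pred.Decidable P → ∀ k → P k →
        ∃ λ m → P m × (∀ j → P j → m ≤ j)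
least P? zero    pk = 0 , pk , λ _ _ → z≤n
least P? (suc k) pk with P? 0
... | yes p0 = 0 , p0 , λ _ _ → z≤n
... | no ¬p0 with least (P? ∘ suc) k pk
...   | m , pm , min = suc m , pm , λ where
          zero    p0 → contradiction p0 ¬p0
          (suc j) pj → s≤s (min j pj)

module _ {n : ℕ} (G : SimpleGraph n) where
  open SimpleGraph G

  Walk : Rel (Fin n) 0ℓ
  Walk = Star Adj

  Connected : Set
  Connected = ∀ i j → Walk i j

  WalkOfLength : Fin n → Fin n → ℕ → Set
  WalkOfLength i j k = Σ (Walk i j) λ w → len w ≡ k

  walkOfLength? : ∀ i j → Pred.Decidable (WalkOfLength i j)
  walkOfLength? i j zero =
    map′ (λ { refl → ε , refl }) (λ { (ε , _) → refl }) (i ≟ j)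
  walkOfLength? i j (suc k) =
    map′ (λ { (_ , e , w , p) → e ◅ w , cong suc p })
         (λ { (e ◅ w , p) → _ , e , w , suc-injective p })
         (any? λ h → adj? i h ×-dec walkOfLength? h j k)

  distance : Connected → ∀ i j →
             ∃ λ m → WalkOfLength i j m × (∀ k → WalkOfLength i j k → m ≤ k)
  distance conn i j =
    least (walkOfLength? i j) (len (conn i j)) (conn i j , refl)

  -- Connectedness only bounds the search for the minimal length of a walk from i to j.
  d : Connected → Fin n → Fin n → ℕ
  d conn i j = proj₁ (distance conn i j)

  record Subgraph : Set₁ where
    field
      V        : Pred (Fin n) 0ℓ
      E        : Rel (Fin n) 0ℓ
      E-sym    : Symmetric E
      E⇒Adj    : ∀ {x y} → E x y → Adj x y
      E⇒V      : ∀ {x y} → E x y → V x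

  walkSubgraph : ∀ {i j} → Walk i j → Subgraph
  walkSubgraph w = record
    { V     = Visits w
    ; E     = Traverses w
    ; E-sym = swap
    ; E⇒Adj = traverses⇒R symm w
    ; E⇒V   = traverses-visits w
    }

  edgeSubgraph : ∀ {u v} → Adj u v → Subgraph
  edgeSubgraph e = walkSubgraph (e ◅ ε)

module _ {n : ℕ} {G : SimpleGraph n} where

  infixl 6 _∪_
  infix  4 _≈_

  _∪_ : Subgraph G → Subgraph G → Subgraph G
  H ∪ K = record
    { V     = H.V Pred.∪ K.V
    ; E     = λ x y → H.E x y ⊎ K.E x y
    ; E-sym = [ inj₁ ∘ H.E-sym , inj₂ ∘ K.E-sym ]
    ; E⇒Adj = [ H.E⇒Adj , K.E⇒Adj ]
    ; E⇒V   = [ inj₁ ∘ H.E⇒V , inj₂ ∘ K.E⇒V ]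
    }
    where
      module H = Subgraph H
      module K = Subgraph K

  _≈_ : Subgraph G → Subgraph G → Set
  H ≈ K = (∀ x → H.V x ⇔ K.V x) × (∀ x y → H.E x y ⇔ K.E x y)
    where
      module H = Subgraph H
      module K = Subgraph K

  module _ (H : Subgraph G) where
    private module H = Subgraph H

    ConnectedSubgraph : Set
    ConnectedSubgraph = ∀ {x y} → H.V x → H.V y → Star H.E x y

    closedWalkSubgraph : ∀ {x} → Star H.E x x → Subgraph G
    closedWalkSubgraph c = record
      { V     = Visits c
      ; E     = Traverses c
      ; E-sym = swap
      ; E⇒Adj = H.E⇒Adj ∘ traverses⇒R H.E-sym c
      ; E⇒V   = traverses-visits c
      }

    -- A cycle is a subgraph, so closed walks differing only in their starting
    -- point or direction represent the same cycle.
    record OddUnicyclic : Set where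
      field
        connected : ConnectedSubgraph
        {base}    : Fin n
        cycle     : Star H.E base base
        isCycle   : IsCycle cycle
        unique    : ∀ {x} (c : Star H.E x x) → IsCycle c →
                    closedWalkSubgraph c ≈ closedWalkSubgraph cycle
        odd       : 2 ∤ len cycle

{-# OPTIONS --safe #-}

-- Cut a shortest walk from i to v at its last vertex y on γ, and replace the part
-- before y by the part of γ up to y.  The union is then a path from i to y
-- attached to a cycle that runs from y to u, along {u,v} and back to y; the two
-- arms of the cycle have equal length.  The cycle is the only one: the edges of any
-- cycle form a leafless set, such a set cannot use the pendant path, and inside a
-- cycle it propagates from each edge to the next.

module Submission where

open import Defs
open import Data.Fin using (Fin)
open import Data.Fin.Properties using (_≟_)
open import Data.List as List using (List; []; _∷_; _++_; map; length)
open import Data.List.Membership.DecPropositional using (_∈?_)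
open import Data.List.Membership.Propositional using (_∈_)
open import Data.List.Membership.Propositional.Properties
  using (∈-map⁺; ∈-map⁻; ∈-++⁺ˡ; ∈-++⁺ʳ; ∈-++⁻)
open import Data.List.Properties using (map-++; map-∘; length-++; length-map)
open import Data.List.Relation.Binary.Permutation.Propositional
  using (_↭_; ↭⇒↭ₛ; ↭-refl; ↭-sym; ↭-trans; ↭-reflexive; prep; swap)
open import Data.List.Relation.Binary.Permutation.Propositional.Properties
  using (∈-resp-↭; ↭-length; drop-∷; map⁺; ↭-reverse; ++-comm; ++⁺ˡ)
import Data.List.Relation.Binary.Permutation.Setoid.Properties as SetoidPerm
open import Data.List.Relation.Unary.All as All using ([])
open import Data.List.Relation.Unary.AllPairs using ([]; _∷_)
open import Data.List.Relation.Unary.Any using (here; there)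
open import Data.List.Relation.Unary.Unique.Propositional using (Unique)
open import Data.List.Relation.Unary.Unique.Propositional.Properties
  using (++⁺; Unique[x∷xs]⇒x∉xs)
open import Data.Nat using (ℕ; suc; _+_; _*_; _≤_; z≤n; s≤s)
open import Data.Nat.Divisibility using (_∣_; _∤_; ∣m+n∣m⇒∣n; divides; ∣1⇒≡1)
open import Data.Nat.Properties
  using (≤-trans; ≤-reflexive; ≤-antisym; +-cancelˡ-≤; +-cancelʳ-≤; +-cancelˡ-≡; 1+n≰n; m≤n+m;
         module ≤-Reasoning)
open import Data.Nat.Tactic.RingSolver using (solve)
open import Data.Product as Product using (Σ; ∃; _×_; _,_; proj₁; proj₂)
open import Data.Sum as Sum using (_⊎_; inj₁; inj₂; [_,_])
open import Function using (_∘_; _⇔_; mk⇔; module Equivalence)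
open import Level using (0ℓ)
open import Relation.Binary using (Rel; Symmetric)
open import Relation.Binary.Construct.Closure.ReflexiveTransitive
  using (Star; ε; _◅_; _◅◅_; reverse; revApp)
open import Relation.Binary.PropositionalEquality
  using (_≡_; _≢_; refl; sym; trans; cong; subst; module ≡-Reasoning)
import Relation.Binary.PropositionalEquality.Properties as ≡
open import Relation.Nullary using (¬_; yes; no; contradiction)
open import Relation.Unary using (Pred; Decidable)

Unique-resp-↭ : ∀ {A : Set} {xs ys : List A} → xs ↭ ys → Unique xs → Unique ys
Unique-resp-↭ {A} p = SetoidPerm.Unique-resp-↭ (≡.setoid A) (↭⇒↭ₛ p)

unique-map-injective : ∀ {A B : Set} (f : A → B) {xs a b} → Unique (map f xs) →
                       a ∈ xs → b ∈ xs → f a ≡ f b → a ≡ b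
unique-map-injective f uniq       (here refl) (here refl) eq = refl
unique-map-injective f uniq       (here refl) (there b∈)  eq =
  contradiction (subst (_∈ map f _) (sym eq) (∈-map⁺ f b∈)) (Unique[x∷xs]⇒x∉xs uniq)
unique-map-injective f uniq       (there a∈)  (here refl) eq =
  contradiction (subst (_∈ map f _) eq (∈-map⁺ f a∈)) (Unique[x∷xs]⇒x∉xs uniq)
unique-map-injective f (_ ∷ uniq) (there a∈)  (there b∈)  eq =
  unique-map-injective f uniq a∈ b∈ eq

2∤n+1+n : ∀ n → 2 ∤ n + suc n
2∤n+1+n n 2∣ = contradiction (∣1⇒≡1 (∣m+n∣m⇒∣n (subst (2 ∣_) eq 2∣) (divides n refl))) λ ()
  where
  eq : n + suc n ≡ n * 2 + 1
  eq = solve (n ∷ [])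

module _ {V : Set} {R : Rel V 0ℓ} where

  targets sources : ∀ {i j} → Star R i j → List V
  targets w = map proj₂ (steps w)
  sources w = map proj₁ (steps w)

  Simple : ∀ {i j} → Star R i j → Set
  Simple {i} w = Unique (i ∷ targets w)

  steps-◅◅ : ∀ {i j k} (w : Star R i j) (w′ : Star R j k) → steps (w ◅◅ w′) ≡ steps w ++ steps w′
  steps-◅◅ ε       w′ = refl
  steps-◅◅ (_ ◅ w) w′ = cong (_ ∷_) (steps-◅◅ w w′)

  len-◅◅ : ∀ {i j k} (w : Star R i j) (w′ : Star R j k) → len (w ◅◅ w′) ≡ len w + len w′
  len-◅◅ w w′ = trans (cong length (steps-◅◅ w w′)) (length-++ (steps w))

  steps-revApp : (s : Symmetric R) → ∀ {i j k} (w : Star R j i) (w′ : Star R j k) →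
                 steps (revApp s w w′) ≡ map Product.swap (steps w) List.ʳ++ steps w′
  steps-revApp s ε       w′ = refl
  steps-revApp s (e ◅ w) w′ = steps-revApp s w (s e ◅ w′)

  steps-reverse : (s : Symmetric R) → ∀ {i j} (w : Star R i j) →
                  steps (reverse {U = R} s w) ↭ map Product.swap (steps w)
  steps-reverse s w = ↭-trans (↭-reflexive (steps-revApp s w ε)) (↭-reverse _)

  len-reverse : (s : Symmetric R) → ∀ {i j} (w : Star R i j) → len (reverse {U = R} s w) ≡ len w
  len-reverse s w = trans (↭-length (steps-reverse s w)) (length-map _ (steps w))

  targets↭sources : ∀ {i j} (w : Star R i j) → i ∷ targets w ↭ j ∷ sources w
  targets↭sources ε       = ↭-refl
  targets↭sources (_ ◅ w) = ↭-trans (prep _ (targets↭sources w)) (swap _ _ ↭-refl)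

  targets-reverse : (s : Symmetric R) → ∀ {i j} (w : Star R i j) →
                    j ∷ targets (reverse {U = R} s w) ↭ i ∷ targets w
  targets-reverse s w =
    ↭-trans (prep _ (↭-trans (map⁺ proj₂ (steps-reverse s w)) (↭-reflexive (sym (map-∘ (steps w))))))
            (↭-sym (targets↭sources w))

  traverses-reverse : (s : Symmetric R) → ∀ {i j} (w : Star R i j) {x y} →
                      Traverses (reverse {U = R} s w) x y ⇔ Traverses w x y
  traverses-reverse s w = mk⇔ (Sum.swap ∘ Sum.map to to) (Sum.swap ∘ Sum.map from from)
    where
    to : ∀ {x y} → (x , y) ∈ steps (reverse s w) → (y , x) ∈ steps w
    to p with ∈-map⁻ Product.swap (∈-resp-↭ (steps-reverse s w) p)
    ... | _ , q , refl = q

    from : ∀ {x y} → (x , y) ∈ steps w → (y , x) ∈ steps (reverse s w)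
    from p = ∈-resp-↭ (↭-sym (steps-reverse s w)) (∈-map⁺ Product.swap p)

  traverses-◅◅⁻ : ∀ {i j k} (w : Star R i j) (w′ : Star R j k) {x y} →
                  Traverses (w ◅◅ w′) x y → Traverses w x y ⊎ Traverses w′ x y
  traverses-◅◅⁻ w w′ t rewrite steps-◅◅ w w′ =
    [ Sum.map inj₁ inj₁ ∘ ∈-++⁻ (steps w) , Sum.map inj₂ inj₂ ∘ ∈-++⁻ (steps w) ] t

  traverses-◅◅⁺ˡ : ∀ {i j k} (w : Star R i j) (w′ : Star R j k) {x y} →
                   Traverses w x y → Traverses (w ◅◅ w′) x y
  traverses-◅◅⁺ˡ w w′ t rewrite steps-◅◅ w w′ = Sum.map ∈-++⁺ˡ ∈-++⁺ˡ t

  traverses-◅◅⁺ʳ : ∀ {i j k} (w : Star R i j) (w′ : Star R j k) {x y} →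
                   Traverses w′ x y → Traverses (w ◅◅ w′) x y
  traverses-◅◅⁺ʳ w w′ t rewrite steps-◅◅ w w′ = Sum.map (∈-++⁺ʳ (steps w)) (∈-++⁺ʳ (steps w)) t

  visits-◅◅⁺ʳ : ∀ {i j k} (w : Star R i j) (w′ : Star R j k) {x} → Visits w′ x → Visits (w ◅◅ w′) x
  visits-◅◅⁺ʳ ε       w′ p = p
  visits-◅◅⁺ʳ (_ ◅ w) w′ p = there (visits-◅◅⁺ʳ w w′ p)

  visits-end : ∀ {i j} (w : Star R i j) → Visits w j
  visits-end ε       = here refl
  visits-end (_ ◅ w) = there (visits-end w)

  visits⇒traverses : ∀ {i} (c : Star R i i) → 1 ≤ len c → ∀ {x} → Visits c x → ∃ (Traverses c x)
  visits⇒traverses (_ ◅ _) _ (here refl) = _ , inj₁ (here refl)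
  visits⇒traverses c       _ (there p) with ∈-map⁻ proj₂ p
  ... | _ , q , refl = _ , inj₂ q

  splitVisit : ∀ {i j} (w : Star R i j) {x} → Visits w x →
               Σ (Star R i x) λ w₁ → Σ (Star R x j) λ w₂ → w ≡ w₁ ◅◅ w₂
  splitVisit w       (here refl) = ε , w , refl
  splitVisit (e ◅ w) (there p) with splitVisit w p
  ... | w₁ , w₂ , refl = e ◅ w₁ , w₂ , refl

  splitStep : ∀ {i j} (w : Star R i j) {p q} → (p , q) ∈ steps w →
              Σ (Star R i p) λ w₁ → Σ (R p q) λ e → Σ (Star R q j) λ w₂ → w ≡ w₁ ◅◅ e ◅ w₂
  splitStep (e ◅ w) (here refl) = ε , e , w , refl
  splitStep (e ◅ w) (there p) with splitStep w p
  ... | w₁ , f , w₂ , refl = e ◅ w₁ , f , w₂ , refl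

  splitLast : ∀ {P : Pred V 0ℓ} → Decidable P → ∀ {i j} (w : Star R i j) →
              (∀ {x} → Visits w x → ¬ P x) ⊎
              ∃ λ y → Σ (Star R i y) λ w₁ → Σ (Star R y j) λ w₂ →
                w ≡ w₁ ◅◅ w₂ × P y × (∀ {x} → x ∈ targets w₂ → ¬ P x)
  splitLast P? {i} ε with P? i
  ... | yes pi = inj₂ (_ , ε , ε , refl , pi , λ ())
  ... | no ¬pi = inj₁ λ { (here refl) → ¬pi }
  splitLast P? {i} (e ◅ w) with splitLast P? w
  ... | inj₂ (y , w₁ , w₂ , refl , py , ¬p) = inj₂ (y , e ◅ w₁ , w₂ , refl , py , ¬p)
  ... | inj₁ ¬p with P? i
  ...   | yes pi = inj₂ (_ , ε , e ◅ w , refl , pi , ¬p)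
  ...   | no ¬pi = inj₁ λ { (here refl) → ¬pi ; (there q) → ¬p q }

  lift : ∀ {S : Rel V 0ℓ} {i j} (w : Star R i j) → (∀ {x y} → (x , y) ∈ steps w → S x y) →
         Σ (Star S i j) λ w′ → steps w′ ≡ steps w
  lift ε       f = ε , refl
  lift (_ ◅ w) f with lift w (f ∘ there)
  ... | w′ , eq = f (here refl) ◅ w′ , cong (_ ∷_) eq

  simple-◅◅-disjoint : ∀ {i j k} (w : Star R i j) (w′ : Star R j k) → Simple (w ◅◅ w′) →
                       ∀ {x y} → (x , y) ∈ steps w → ¬ Visits w′ x
  simple-◅◅-disjoint (_ ◅ w) w′ uniq       (here refl) v =
    Unique[x∷xs]⇒x∉xs uniq (visits-◅◅⁺ʳ w w′ v)
  simple-◅◅-disjoint (_ ◅ w) w′ (_ ∷ uniq) (there p)   v = simple-◅◅-disjoint w w′ uniq p v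

  shortest-◅◅ˡ : ∀ {i j k} (w : Star R i j) (w′ : Star R j k) →
                 IsShortest (w ◅◅ w′) → IsShortest w
  shortest-◅◅ˡ w w′ short w″ = +-cancelʳ-≤ (len w′) _ _ (begin
    len w + len w′    ≡⟨ len-◅◅ w w′ ⟨
    len (w ◅◅ w′)     ≤⟨ short (w″ ◅◅ w′) ⟩
    len (w″ ◅◅ w′)    ≡⟨ len-◅◅ w″ w′ ⟩
    len w″ + len w′   ∎)
    where open ≤-Reasoning

  shortest-◅◅ʳ : ∀ {i j k} (w : Star R i j) (w′ : Star R j k) →
                 IsShortest (w ◅◅ w′) → IsShortest w′
  shortest-◅◅ʳ w w′ short w″ = +-cancelˡ-≤ (len w) _ _ (begin
    len w + len w′    ≡⟨ len-◅◅ w w′ ⟨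
    len (w ◅◅ w′)     ≤⟨ short (w ◅◅ w″) ⟩
    len (w ◅◅ w″)     ≡⟨ len-◅◅ w w″ ⟩
    len w + len w″    ∎)
    where open ≤-Reasoning

  shortest⇒simple : ∀ {i j} (w : Star R i j) → IsShortest w → Simple w
  shortest⇒simple ε       short = [] ∷ []
  shortest⇒simple {i} (e ◅ w) short =
    All.tabulate (λ { p refl → i∉ p }) ∷ shortest⇒simple w (shortest-◅◅ʳ (e ◅ ε) w short)
    where
    i∉ : ¬ Visits w i
    i∉ p with splitVisit w p
    ... | w₁ , w₂ , refl = 1+n≰n (≤-trans (short w₂)
                             (≤-trans (m≤n+m (len w₂) (len w₁)) (≤-reflexive (sym (len-◅◅ w₁ w₂)))))

  rotate : ∀ {i} (c : Star R i i) {p q} → (p , q) ∈ steps c →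
           Σ (R p q) λ e → Σ (Star R q p) λ w → steps c ↭ steps (e ◅ w)
  rotate c pq∈ with splitStep c pq∈
  ... | w₁ , e , w₂ , refl = e , w₂ ◅◅ w₁ , ↭-trans (↭-reflexive (steps-◅◅ w₁ (e ◅ w₂)))
        (↭-trans (++-comm (steps w₁) (steps (e ◅ w₂)))
                 (↭-reflexive (cong (_ ∷_) (sym (steps-◅◅ w₂ w₁)))))

  isCycle-resp-↭ : ∀ {i j} (c : Star R i i) (c′ : Star R j j) → steps c ↭ steps c′ →
                   IsCycle c → IsCycle c′
  isCycle-resp-↭ c c′ p (3≤ , uniq) =
    ≤-trans 3≤ (≤-reflexive (↭-length p)) , Unique-resp-↭ (map⁺ proj₂ p) uniq

  lastStep : ∀ {i j k} (e : R i j) (w : Star R j k) → ∃ λ y → (y , k) ∈ steps (e ◅ w)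
  lastStep e ε       = _ , here refl
  lastStep e (f ◅ w) = Product.map₂ there (lastStep f w)

  firstStep-successor : ∀ {p q} (e : R p q) (w : Star R q p) → IsCycle (e ◅ w) →
                        ∃ λ r → r ≢ p × (q , r) ∈ steps (e ◅ w)
  firstStep-successor e ε           (s≤s () , _)
  firstStep-successor e (f ◅ ε)     (s≤s (s≤s ()) , _)
  firstStep-successor e (f ◅ g ◅ w) (_ , _ ∷ uniq) =
    _ , (λ { refl → Unique[x∷xs]⇒x∉xs uniq (∈-map⁺ proj₂ (proj₂ (lastStep g w))) }) ,
    there (here refl)

  firstStep-predecessor : ∀ {p q} (e : R p q) (w : Star R q p) → IsCycle (e ◅ w) →
                          ∃ λ r → r ≢ q × (r , p) ∈ steps (e ◅ w)
  firstStep-predecessor e ε           (s≤s () , _)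
  firstStep-predecessor e (f ◅ ε)     (s≤s (s≤s ()) , _)
  firstStep-predecessor e (f ◅ g ◅ w) (_ , uniq) with lastStep g w
  ... | r , rp∈ = r , (λ { refl → Unique[x∷xs]⇒x∉xs uniq (visits-source (g ◅ w) rp∈) }) ,
                  there (there rp∈)

Leafless : {V : Set} → Rel V 0ℓ → Set
Leafless F = ∀ {p q} → F p q → ∃ λ r → r ≢ p × F q r

module _ {V : Set} {R : Rel V 0ℓ} where

  isCycle⇒leafless : ∀ {i} (c : Star R i i) → IsCycle c → Leafless (Traverses c)
  isCycle⇒leafless c cyc (inj₁ pq∈) with rotate c pq∈
  ... | e , w , perm with firstStep-successor e w (isCycle-resp-↭ c (e ◅ w) perm cyc)
  ...   | r , r≢p , qr∈ = r , r≢p , inj₁ (∈-resp-↭ (↭-sym perm) qr∈)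
  isCycle⇒leafless c cyc (inj₂ qp∈) with rotate c qp∈
  ... | e , w , perm with firstStep-predecessor e w (isCycle-resp-↭ c (e ◅ w) perm cyc)
  ...   | r , r≢p , rq∈ = r , r≢p , inj₂ (∈-resp-↭ (↭-sym perm) rq∈)

  leafless-avoids-pendant :
    ∀ {F K : Rel V 0ℓ} → Symmetric F → Leafless F →
    ∀ {i j} (w : Star R i j) → Simple w → (∀ {x y z} → (x , y) ∈ steps w → ¬ K x z) →
    (∀ {x y} → F x y → Traverses w x y ⊎ K x y) → ∀ {x y} → F x y → K x y
  leafless-avoids-pendant F-sym leafless ε simple pend F⊆ f with F⊆ f
  ... | inj₂ k         = k
  ... | inj₁ (inj₁ ())
  ... | inj₁ (inj₂ ())
  leafless-avoids-pendant {F} {K} F-sym leafless (_◅_ {i} {j} e w) uniq@(_ ∷ simple) pend F⊆ =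
    leafless-avoids-pendant F-sym leafless w simple (pend ∘ there) F⊆′
    where
    ¬Fji : ¬ F j i
    ¬Fji f with leafless f
    ... | r , r≢j , g with F⊆ g
    ...   | inj₂ k                    = pend (here refl) k
    ...   | inj₁ (inj₁ (here refl))   = r≢j refl
    ...   | inj₁ (inj₁ (there ir∈))   = Unique[x∷xs]⇒x∉xs uniq (visits-source w ir∈)
    ...   | inj₁ (inj₂ (here refl))   = r≢j refl
    ...   | inj₁ (inj₂ (there ri∈))   = Unique[x∷xs]⇒x∉xs uniq (there (∈-map⁺ proj₂ ri∈))

    F⊆′ : ∀ {x y} → F x y → Traverses w x y ⊎ K x y
    F⊆′ f with F⊆ f
    ... | inj₂ k                  = inj₂ k
    ... | inj₁ (inj₁ (here refl)) = contradiction (F-sym f) ¬Fji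
    ... | inj₁ (inj₁ (there p))   = inj₁ (inj₁ p)
    ... | inj₁ (inj₂ (here refl)) = contradiction f ¬Fji
    ... | inj₁ (inj₂ (there p))   = inj₁ (inj₂ p)

  module _ {i} (c : Star R i i) (uniq : Unique (map proj₂ (steps c)))
           {F : Rel V 0ℓ} (F-sym : Symmetric F) (leafless : Leafless F)
           (F⊆ : ∀ {x y} → F x y → Traverses c x y) where

    private
      uniqueSources : Unique (map proj₁ (steps c))
      uniqueSources = Unique-resp-↭ (drop-∷ (targets↭sources c)) uniq

      propagate : ∀ {p q r} → F p q → (p , q) ∈ steps c → (q , r) ∈ steps c → F q r
      propagate f pq∈ qr∈ with leafless f
      ... | r′ , r′≢p , g with F⊆ g
      ...   | inj₂ r′q∈ =
        contradiction (cong proj₁ (unique-map-injective proj₂ uniq r′q∈ pq∈ refl)) r′≢p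
      ...   | inj₁ qr′∈ with unique-map-injective proj₁ uniqueSources qr′∈ qr∈ refl
      ...     | refl = g

      propagate* : ∀ {p q r} (w : Star R q r) → (∀ {e} → e ∈ steps w → e ∈ steps c) →
                   F p q → (p , q) ∈ steps c → ∀ {x y} → (x , y) ∈ steps w → F x y
      propagate* (_ ◅ w) w⊆c f pq∈ (here refl) = propagate f pq∈ (w⊆c (here refl))
      propagate* (_ ◅ w) w⊆c f pq∈ (there xy∈) =
        propagate* w (w⊆c ∘ there) (propagate f pq∈ (w⊆c (here refl))) (w⊆c (here refl)) xy∈

      steps⊆ : ∀ {p q} → F p q → (p , q) ∈ steps c → ∀ {x y} → (x , y) ∈ steps c → F x y
      steps⊆ f pq∈ xy∈ with rotate c pq∈
      ... | e , w , perm with ∈-resp-↭ perm xy∈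
      ...   | here refl = f
      ...   | there p   = propagate* w (∈-resp-↭ (↭-sym perm) ∘ there) f pq∈ p

    leafless-fills-cycle : ∀ {p q} → F p q → ∀ {x y} → Traverses c x y → F x y
    leafless-fills-cycle f with F⊆ f
    ... | inj₁ pq∈ = [ steps⊆ f pq∈ , F-sym ∘ steps⊆ f pq∈ ]
    ... | inj₂ qp∈ = [ steps⊆ (F-sym f) qp∈ , F-sym ∘ steps⊆ (F-sym f) qp∈ ]

module _ {n : ℕ} {G : SimpleGraph n} where
  open SimpleGraph G

  walk-inside : (H : Subgraph G) (let module H = Subgraph H) → ∀ {i j} (w : Walk G i j) →
                (∀ {x y} → Traverses w x y → H.E x y) → ∀ {x} → Visits w x → Star H.E i x
  walk-inside H w w⊆H x∈ with splitVisit w x∈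
  ... | w₁ , w₂ , refl = proj₁ (lift w₁ (w⊆H ∘ traverses-◅◅⁺ˡ w₁ w₂ ∘ inj₁))

  lollipop⇒oddUnicyclic :
    (H : Subgraph G) (let module H = Subgraph H) → ConnectedSubgraph H →
    ∀ {i y} (τ : Walk G i y) → Simple τ →
    (c : Walk G y y) → IsCycle c → 2 ∤ len c →
    (∀ {a b z} → (a , b) ∈ steps τ → ¬ Traverses c a z) →
    (∀ {a b} → H.E a b → Traverses τ a b ⊎ Traverses c a b) →
    (∀ {a b} → Traverses c a b → H.E a b) →
    OddUnicyclic H
  lollipop⇒oddUnicyclic H conn τ simple c cyc odd pend H⊆ c⊆H
    with lift c (c⊆H ∘ inj₁)
  ... | c′ , eq = record
    { connected = conn
    ; cycle     = c′
    ; isCycle   = subst (λ s → 3 ≤ length s × Unique (map proj₂ s)) (sym eq) cyc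
    ; unique    = unique
    ; odd       = subst (λ s → 2 ∤ length s) (sym eq) odd
    }
    where
    module H = Subgraph H

    c⇒c′ : ∀ {a b} → Traverses c a b → Traverses c′ a b
    c⇒c′ {a} {b} = subst (λ s → (a , b) ∈ s ⊎ (b , a) ∈ s) (sym eq)

    c′⇒c : ∀ {a b} → Traverses c′ a b → Traverses c a b
    c′⇒c {a} {b} = subst (λ s → (a , b) ∈ s ⊎ (b , a) ∈ s) eq

    unique : ∀ {x} (e : Star H.E x x) → IsCycle e →
             closedWalkSubgraph H e ≈ closedWalkSubgraph H c′
    unique e e-cyc =
        (λ x → mk⇔ (λ v → traverses-visits c′ (to (proj₂ (visits⇒traverses e 1≤e v))))
                   (λ v → traverses-visits e (from (proj₂ (visits⇒traverses c′ 1≤c′ v)))))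
      , (λ x y → mk⇔ to from)
      where
      1≤e : 1 ≤ len e
      1≤e = ≤-trans (s≤s z≤n) (proj₁ e-cyc)

      1≤c′ : 1 ≤ len c′
      1≤c′ = subst (λ s → 1 ≤ length s) (sym eq) (≤-trans (s≤s z≤n) (proj₁ cyc))

      leafless : Leafless (Traverses e)
      leafless = isCycle⇒leafless e e-cyc

      e⊆c : ∀ {a b} → Traverses e a b → Traverses c a b
      e⊆c = leafless-avoids-pendant {K = Traverses c} Sum.swap leafless τ simple pend
              (H⊆ ∘ traverses⇒R H.E-sym e)

      to : ∀ {a b} → Traverses e a b → Traverses c′ a b
      to = c⇒c′ ∘ e⊆c

      from : ∀ {a b} → Traverses c′ a b → Traverses e a b
      from = leafless-fills-cycle c (proj₂ cyc) Sum.swap leafless e⊆c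
               (proj₂ (visits⇒traverses e 1≤e (here refl))) ∘ c′⇒c

  shortest⇒len≡d : (conn : Connected G) → ∀ {i j} (w : Walk G i j) → IsShortest w →
                   len w ≡ d G conn i j
  shortest⇒len≡d conn {i} {j} w short with distance G conn i j
  ... | _ , (w′ , refl) , least = ≤-antisym (short w′) (least _ (w , refl))

  shortestWalk : Connected G → ∀ i j → Σ (Walk G i j) IsShortest
  shortestWalk conn i j with distance G conn i j
  ... | _ , (w , refl) , least = w , λ w′ → least _ (w′ , refl)

  fork⇒oddUnicyclic :
    ∀ {i y u v} (τ : Walk G i y) (α : Walk G y u) (β : Walk G y v) (uv : Adj u v) →
    IsShortest (τ ◅◅ α) → IsShortest (τ ◅◅ β) → len α ≡ len β →
    (∀ {x} → x ∈ targets β → ¬ Visits α x) →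
    OddUnicyclic (walkSubgraph G (τ ◅◅ β) ∪ walkSubgraph G (τ ◅◅ α) ∪ edgeSubgraph G uv)
  fork⇒oddUnicyclic {i} {y} {u} {v} τ α β uv shortα shortβ lenα≡lenβ β∌α =
    lollipop⇒oddUnicyclic H connected τ (shortest⇒simple τ (shortest-◅◅ˡ τ α shortα))
      c (3≤len-c , unique-c) (subst (2 ∤_) (sym len-c) (2∤n+1+n (len α)))
      pendant H⊆ c⊆H
    where
    H : Subgraph G
    H = walkSubgraph G (τ ◅◅ β) ∪ walkSubgraph G (τ ◅◅ α) ∪ edgeSubgraph G uv
    module H = Subgraph H

    β⁻¹ : Walk G v y
    β⁻¹ = reverse symm β

    c : Walk G y y
    c = α ◅◅ uv ◅ β⁻¹

    simpleα : Simple α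
    simpleα = shortest⇒simple α (shortest-◅◅ʳ τ α shortα)

    simpleβ : Simple β
    simpleβ = shortest⇒simple β (shortest-◅◅ʳ τ β shortβ)

    len-c : len c ≡ len α + suc (len α)
    len-c = trans (len-◅◅ α (uv ◅ β⁻¹))
      (cong (λ k → len α + suc k) (trans (len-reverse symm β) (sym lenα≡lenβ)))

    1≤lenα : ∀ {v} (α : Walk G y u) (β : Walk G y v) → Adj u v → len α ≡ len β → 1 ≤ len α
    1≤lenα ε       ε uv _ = contradiction uv (irrefl refl)
    1≤lenα (_ ◅ _) _ _  _ = s≤s z≤n

    3≤len-c : 3 ≤ len c
    3≤len-c = subst (3 ≤_) (sym len-c) (3≤ (1≤lenα α β uv lenα≡lenβ))
      where
      3≤ : ∀ {k} → 1 ≤ k → 3 ≤ k + suc k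
      3≤ {suc k} _ = s≤s (≤-trans (s≤s (s≤s z≤n)) (m≤n+m (suc (suc k)) k))

    targets-c : targets α ++ y ∷ targets β ↭ targets c
    targets-c = ↭-sym (↭-trans
      (↭-reflexive (trans (cong (map proj₂) (steps-◅◅ α (uv ◅ β⁻¹)))
                          (map-++ proj₂ (steps α) (steps (uv ◅ β⁻¹)))))
      (++⁺ˡ (targets α) (targets-reverse symm β)))

    unique-c : Unique (targets c)
    unique-c with simpleα
    ... | _ ∷ uniqueα = Unique-resp-↭ targets-c (++⁺ uniqueα simpleβ λ where
      (y∈α , here refl) → Unique[x∷xs]⇒x∉xs simpleα y∈α
      (x∈α , there x∈β) → β∌α x∈β (there x∈α))

    c⁻ : ∀ {a b} → Traverses c a b →
         Traverses α a b ⊎ Traverses {R = Adj} (uv ◅ ε) a b ⊎ Traverses β a b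
    c⁻ = Sum.map₂ (Sum.map₂ (Equivalence.to (traverses-reverse symm β)) ∘ traverses-◅◅⁻ (uv ◅ ε) β⁻¹)
         ∘ traverses-◅◅⁻ α (uv ◅ β⁻¹)

    c⁺β : ∀ {a b} → Traverses β a b → Traverses c a b
    c⁺β = traverses-◅◅⁺ʳ α (uv ◅ β⁻¹) ∘ traverses-◅◅⁺ʳ (uv ◅ ε) β⁻¹
          ∘ Equivalence.from (traverses-reverse symm β)

    H⊆ : ∀ {a b} → H.E a b → Traverses τ a b ⊎ Traverses c a b
    H⊆ (inj₁ (inj₁ t)) = Sum.map₂ c⁺β (traverses-◅◅⁻ τ β t)
    H⊆ (inj₁ (inj₂ t)) = Sum.map₂ (traverses-◅◅⁺ˡ α (uv ◅ β⁻¹)) (traverses-◅◅⁻ τ α t)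
    H⊆ (inj₂ t)        = inj₂ (traverses-◅◅⁺ʳ α (uv ◅ β⁻¹) (traverses-◅◅⁺ˡ (uv ◅ ε) β⁻¹ t))

    c⊆H : ∀ {a b} → Traverses c a b → H.E a b
    c⊆H t with c⁻ t
    ... | inj₁ tα        = inj₁ (inj₂ (traverses-◅◅⁺ʳ τ α tα))
    ... | inj₂ (inj₁ te) = inj₂ te
    ... | inj₂ (inj₂ tβ) = inj₁ (inj₁ (traverses-◅◅⁺ʳ τ β tβ))

    traverses-c⇒visits : ∀ {a b} → Traverses c a b → Visits α a ⊎ Visits β a
    traverses-c⇒visits t with c⁻ t
    ... | inj₁ tα                      = inj₁ (traverses-visits α tα)
    ... | inj₂ (inj₁ (inj₁ (here refl))) = inj₁ (visits-end α)
    ... | inj₂ (inj₁ (inj₂ (here refl))) = inj₂ (visits-end β)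
    ... | inj₂ (inj₂ tβ)               = inj₂ (traverses-visits β tβ)

    pendant : ∀ {a b z} → (a , b) ∈ steps τ → ¬ Traverses c a z
    pendant ab∈ t =
      [ simple-◅◅-disjoint τ α (shortest⇒simple _ shortα) ab∈
      , simple-◅◅-disjoint τ β (shortest⇒simple _ shortβ) ab∈
      ] (traverses-c⇒visits t)

    reach : ∀ {x} → H.V x → Star H.E i x
    reach (inj₁ (inj₁ x∈)) = walk-inside H (τ ◅◅ β) (inj₁ ∘ inj₁) x∈
    reach (inj₁ (inj₂ x∈)) = walk-inside H (τ ◅◅ α) (inj₁ ∘ inj₂) x∈
    reach (inj₂ (here refl)) = walk-inside H (τ ◅◅ α) (inj₁ ∘ inj₂) (visits-end (τ ◅◅ α))
    reach (inj₂ (there (here refl))) = walk-inside H (τ ◅◅ β) (inj₁ ∘ inj₁) (visits-end (τ ◅◅ β))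

    connected : ConnectedSubgraph H
    connected x∈ y∈ = reverse H.E-sym (reach x∈) ◅◅ reach y∈

lemma2p4 : (n : ℕ) → 2 ≤ n →
    (G : SimpleGraph n) → 1 ≤ SimpleGraph.size G →
    (conn : Connected G) →
    (u v : Fin n) (uv : SimpleGraph.Adj G u v) (i : Fin n) →
    d G conn i u ≡ d G conn i v →
    (γ : Walk G i u) → IsShortest γ →
    Σ (Walk G i v) λ γ′ →
    IsShortest γ′ ×
    OddUnicyclic (walkSubgraph G γ′ ∪ walkSubgraph G γ ∪ edgeSubgraph G uv)
lemma2p4 n _ G _ conn u v uv i du≡dv γ γ-short with shortestWalk {G = G} conn i v
... | δ , δ-short with splitLast (λ x → _∈?_ _≟_ x (i ∷ targets γ)) δ
...   | inj₁ i∉γ = contradiction (here refl) (i∉γ (here refl))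
...   | inj₂ (y , δ₁ , β , refl , y∈γ , β∌γ) with splitVisit γ y∈γ
...     | τ , α , refl =
  τ ◅◅ β , short , fork⇒oddUnicyclic τ α β uv γ-short short lenα≡lenβ
                     (λ x∈β → β∌γ x∈β ∘ visits-◅◅⁺ʳ τ α)
  where
  open ≡-Reasoning

  lenτ≡lenδ₁ : len τ ≡ len δ₁
  lenτ≡lenδ₁ = ≤-antisym (shortest-◅◅ˡ τ α γ-short δ₁) (shortest-◅◅ˡ δ₁ β δ-short τ)

  len-τβ : len (τ ◅◅ β) ≡ len (δ₁ ◅◅ β)
  len-τβ = begin
    len (τ ◅◅ β)     ≡⟨ len-◅◅ τ β ⟩
    len τ + len β    ≡⟨ cong (_+ len β) lenτ≡lenδ₁ ⟩
    len δ₁ + len β   ≡⟨ len-◅◅ δ₁ β ⟨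
    len (δ₁ ◅◅ β)    ∎

  short : IsShortest (τ ◅◅ β)
  short w = ≤-trans (≤-reflexive len-τβ) (δ-short w)

  lenα≡lenβ : len α ≡ len β
  lenα≡lenβ = +-cancelˡ-≡ (len τ) _ _ (begin
    len τ + len α   ≡⟨ len-◅◅ τ α ⟨
    len (τ ◅◅ α)    ≡⟨ shortest⇒len≡d conn (τ ◅◅ α) γ-short ⟩
    d G conn i u    ≡⟨ du≡dv ⟩
    d G conn i v    ≡⟨ shortest⇒len≡d conn (τ ◅◅ β) short ⟨
    len (τ ◅◅ β)    ≡⟨ len-◅◅ τ β ⟩
    len τ + len β   ∎)
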